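{- $$\sum_{n=1}^\infty(M_e(\mathcal{D},n)-M_o(\mathcal{D},n))q^n=\frac{1}{1+q}\sum_{n=1}^\infty q^{n(3n+1)/2}(1-q^{2n+1})-q(q^2;q)_{\infty}.$$
   Context: $(z;q)_\infty=\prod_{j\ge0}(1-zq^j)$. $M_e(\mathcal{D},n)$ (resp. $M_o(\mathcal{D},n)$) is the number of partitions of $n$ into distinct parts with even (resp. odd) crank, where for a partition into distinct parts the crank is its largest part if $1$ is not a part, and is (number of parts) $-2$ if $1$ is a part. -}

module Defs where

import Algebra.Properties.Monoid.Sum
open import Data.Bool using (if_then_else_)
open import Data.Fin using (Fin; toℕ) renaming (zero to fzero; suc to fsuc)
open import Data.Integer using (ℤ; +_; -_; 0ℤ; 1ℤ) renaming (_+_ to _+ᶻ_; _-_ to _-ᶻ_; _*_ to _*ᶻ_)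
open import Data.Integer.Divisibility.Signed using (_∣_; _∣?_)
import Data.Integer.Properties as ℤₚ
open import Data.List using (List; []; _∷_; _++_; map; filter; foldr; length)
import Data.Nat.ListAction as List using (sum)
open import Data.Nat using (ℕ; zero; suc; _+_; _*_; _∸_; _/_; _≤_; _<_; _>_; _⊔_; _≟_; z≤n; s≤s)
open import Data.List.Membership.DecPropositional _≟_ using (_∈?_)
open import Data.List.Membership.Propositional using (_∈_)
open import Data.List.Membership.Propositional.Properties using (∈-map⁺; ∈-map⁻; ∈-++⁺ˡ; ∈-++⁺ʳ; ∈-++⁻; ∈-filter⁺; ∈-filter⁻)
open import Data.List.Properties using (∷-injectiveʳ)
open import Data.List.Relation.Unary.All as All using (All; []; _∷_)
open import Data.List.Relation.Unary.AllPairs using (AllPairs; []; _∷_)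
open import Data.List.Relation.Unary.Any using (here)
open import Data.List.Relation.Unary.Unique.Propositional using (Unique)
import Data.List.Relation.Unary.Unique.Propositional.Properties as Uniqueₚ
import Data.Nat.DivMod as DivMod
import Data.Nat.Properties as ℕₚ
open import Data.Product using (∃; _×_; _,_; proj₁; proj₂)
open import Data.Sum using (inj₁; inj₂)
open import Function using (_⇔_; mk⇔)
open import Relation.Binary.PropositionalEquality
open import Relation.Unary using (Decidable)
open import Relation.Nullary.Decidable using (dec-false)
open import Relation.Nullary using (¬_; does; yes; no; ¬?; contradiction)

open Algebra.Properties.Monoid.Sum ℤₚ.+-0-monoid using (sum)

-- The formal power series ∑ f(n) q^n over ℤ.
Series : Set
Series = ℕ → ℤ

infix 4 _≈_
infixl 6 _⊕_ _⊖_
infixl 7 _⊛_ _·_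
infix 9 q^_

_≈_ : Series → Series → Set
f ≈ g = ∀ n → f n ≡ g n

q^_ : ℕ → Series
(q^ k) n = if does (k ≟ n) then 1ℤ else 0ℤ

𝟘 𝟙 : Series
𝟘 _ = 0ℤ
𝟙 = q^ 0

_⊕_ _⊖_ _⊛_ : Series → Series → Series
(f ⊕ g) n = f n +ᶻ g n
(f ⊖ g) n = f n -ᶻ g n
(f ⊛ g) n = sum {suc n} λ i → f (toℕ i) *ᶻ g (n ∸ toℕ i)

_·_ : ℤ → Series → Series
(c · f) n = c *ᶻ f n

Invertible : Series → Set
Invertible f = ∃ λ g → f ⊛ g ≈ 𝟙

recip : (f : Series) → Invertible f → Series
recip f = proj₁

-- Convergence in the q-adic topology: each coefficient is eventually constant.
Converges : (ℕ → Series) → Set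
Converges s = ∀ n → ∃ λ M → ∀ m → M ≤ m → s m n ≡ s M n

lim : (s : ℕ → Series) → Converges s → Series
lim s c n = s (proj₁ (c n)) n

-- ∑≤ t m = t 1 + ⋯ + t m; the value t 0 is not used.
∑≤ : (ℕ → Series) → ℕ → Series
∑≤ t zero    = 𝟘
∑≤ t (suc m) = ∑≤ t m ⊕ t (suc m)

Summable : (ℕ → Series) → Set
Summable t = Converges (∑≤ t)

∑≥1 : (t : ℕ → Series) → Summable t → Series
∑≥1 t = lim (∑≤ t)

∏< : (ℕ → Series) → ℕ → Series
∏< t zero    = 𝟙
∏< t (suc m) = t m ⊛ ∏< t m

q^-≢ : ∀ {k n} → k ≢ n → (q^ k) n ≡ 0ℤ
q^-≢ {k} {n} k≢n = cong (λ b → if b then 1ℤ else 0ℤ) (dec-false (k ≟ n) k≢n)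

q^-< : ∀ {k n} → n < k → (q^ k) n ≡ 0ℤ
q^-< n<k = q^-≢ λ k≡n → ℕₚ.<⇒≢ n<k (sym k≡n)

sum-zero : ∀ {n} (t : Fin n → ℤ) → (∀ i → t i ≡ 0ℤ) → sum t ≡ 0ℤ
sum-zero {zero}  t t≡0 = refl
sum-zero {suc n} t t≡0 = cong₂ _+ᶻ_ (t≡0 fzero) (sum-zero (λ i → t (fsuc i)) (λ i → t≡0 (fsuc i)))

⊛-low : ∀ f {k n} → n < k → (f ⊛ q^ k) n ≡ 0ℤ
⊛-low f {k} {n} n<k = sum-zero {suc n} _ λ i →
  trans (cong (f (toℕ i) *ᶻ_) (q^-< (ℕₚ.≤-<-trans (ℕₚ.m∸n≤m n (toℕ i)) n<k))) (ℤₚ.*-zeroʳ (f (toℕ i)))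

-- Multiplying by 1 + O(q^(n+1)) does not change the coefficient of q^n.
⊛-unit : ∀ f g n → (∀ k → k ≤ n → f k ≡ 𝟙 k) → (f ⊛ g) n ≡ g n
⊛-unit f g n f≡1 = begin
  f 0 *ᶻ g n +ᶻ sum rest  ≡⟨ cong₂ (λ x y → x *ᶻ g n +ᶻ y) (f≡1 0 z≤n) (sum-zero rest rest≡0) ⟩
  1ℤ *ᶻ g n +ᶻ 0ℤ         ≡⟨ ℤₚ.+-identityʳ _ ⟩
  1ℤ *ᶻ g n               ≡⟨ ℤₚ.*-identityˡ _ ⟩
  g n                     ∎
  where
  open ≡-Reasoning
  rest : Fin n → ℤ
  rest i = f (suc (toℕ i)) *ᶻ g (n ∸ suc (toℕ i))
  rest≡0 : ∀ i → rest i ≡ 0ℤ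
  rest≡0 i = cong (_*ᶻ g (n ∸ suc (toℕ i))) (f≡1 (suc (toℕ i)) (toℕ<n i))
    where open import Data.Fin.Properties using (toℕ<n)

stable⇒Converges : ∀ s → (∀ m n → n < m → s (suc m) n ≡ s m n) → Converges s
stable⇒Converges s step n = suc n , λ m n<m → go (ℕₚ.≤⇒≤′ n<m)
  where
  open import Data.Nat using (_≤′_; ≤′-refl; ≤′-step)
  go : ∀ {m} → suc n ≤′ m → s m n ≡ s (suc n) n
  go ≤′-refl     = refl
  go (≤′-step p) = trans (step _ n (ℕₚ.≤′⇒≤ p)) (go p)

order⇒Summable : ∀ t → (∀ m n → n < suc m → t (suc m) n ≡ 0ℤ) → Summable t
order⇒Summable t t≡0 = stable⇒Converges (∑≤ t) λ m n n<m →
  trans (cong (∑≤ t m n +ᶻ_) (t≡0 m n (ℕₚ.m<n⇒m<1+n n<m))) (ℤₚ.+-identityʳ _)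

1+q-invertible : Invertible (𝟙 ⊕ q^ 1)
1+q-invertible = alt , alt-inverse
  where
  alt : Series
  alt zero    = 1ℤ
  alt (suc n) = - alt n
  alt-inverse : (𝟙 ⊕ q^ 1) ⊛ alt ≈ 𝟙
  alt-inverse zero    = refl
  alt-inverse (suc n) = begin
    1ℤ *ᶻ (- alt n) +ᶻ (1ℤ *ᶻ alt n +ᶻ sum rest)
      ≡⟨ cong₂ _+ᶻ_ (ℤₚ.*-identityˡ (- alt n)) (cong₂ _+ᶻ_ (ℤₚ.*-identityˡ (alt n)) (sum-zero rest λ _ → refl)) ⟩
    (- alt n) +ᶻ (alt n +ᶻ 0ℤ)
      ≡⟨ cong ((- alt n) +ᶻ_) (ℤₚ.+-identityʳ _) ⟩
    (- alt n) +ᶻ alt n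
      ≡⟨ ℤₚ.+-inverseˡ (alt n) ⟩
    0ℤ ∎
    where
    open ≡-Reasoning
    rest : Fin n → ℤ
    rest i = (𝟙 ⊕ q^ 1) (suc (suc (toℕ i))) *ᶻ alt (n ∸ suc (toℕ i))

qPochFactor : Series → ℕ → Series
qPochFactor z j = 𝟙 ⊖ z ⊛ q^ j

qPoch-converges : ∀ z → Converges (∏< (qPochFactor z))
qPoch-converges z = stable⇒Converges _ λ m n n<m →
  ⊛-unit (qPochFactor z m) (∏< (qPochFactor z) m) n λ k k≤n →
    trans (cong (λ x → 𝟙 k -ᶻ x) (⊛-low z (ℕₚ.≤-<-trans k≤n n<m))) (ℤₚ.+-identityʳ _)

-- (z;q)_∞, for an arbitrary series z in q.
⟨_⨾q⟩∞ : Series → Series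
⟨ z ⨾q⟩∞ = lim (∏< (qPochFactor z)) (qPoch-converges z)

record IsDistinctPartition (n : ℕ) (ps : List ℕ) : Set where
  constructor mkDP
  field
    decreasing : AllPairs _>_ ps
    positive   : All (0 <_) ps
    total      : List.sum ps ≡ n

decreasingLists : ℕ → List (List ℕ)
decreasingLists zero    = [] ∷ []
decreasingLists (suc m) = map (suc m ∷_) (decreasingLists m) ++ decreasingLists m

-- Every partition of n into distinct parts is listed exactly once: see ∈-distinctPartitions and
-- distinctPartitions-unique.
distinctPartitions : ℕ → List (List ℕ)
distinctPartitions n = filter (λ ps → List.sum ps ≟ n) (decreasingLists n)

-- In the second branch the crank is the largest part (0 for the empty partition, which never
-- occurs for n ≥ 1).
crank : List ℕ → ℤ
crank ps = if does (1 ∈? ps) then + length ps -ᶻ + 2 else + foldr _⊔_ 0 ps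

EvenCrank OddCrank : List ℕ → Set
EvenCrank ps = + 2 ∣ crank ps
OddCrank ps = ¬ EvenCrank ps

evenCrank? : Decidable EvenCrank
evenCrank? ps = + 2 ∣? crank ps

oddCrank? : Decidable OddCrank
oddCrank? ps = ¬? (evenCrank? ps)

Mₑ Mₒ : ℕ → ℕ
Mₑ n = length (filter evenCrank? (distinctPartitions n))
Mₒ n = length (filter oddCrank? (distinctPartitions n))

decreasingLists-sound : ∀ m {ps} → ps ∈ decreasingLists m →
                        AllPairs _>_ ps × All (0 <_) ps × All (_≤ m) ps
decreasingLists-sound zero (here refl) = [] , [] , []
decreasingLists-sound (suc m) ps∈ with ∈-++⁻ (map (suc m ∷_) (decreasingLists m)) ps∈
... | inj₂ ps∈ʳ = let d , p , b = decreasingLists-sound m ps∈ʳ in d , p , All.map ℕₚ.m≤n⇒m≤1+n b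
... | inj₁ ps∈ˡ with ∈-map⁻ (suc m ∷_) ps∈ˡ
... | _ , qs∈ , refl = let d , p , b = decreasingLists-sound m qs∈ in
  All.map s≤s b ∷ d , s≤s z≤n ∷ p , ℕₚ.≤-refl ∷ All.map ℕₚ.m≤n⇒m≤1+n b

decreasingLists-complete : ∀ m {ps} → AllPairs _>_ ps → All (0 <_) ps → All (_≤ m) ps →
                           ps ∈ decreasingLists m
decreasingLists-complete zero {[]} _ _ _ = here refl
decreasingLists-complete zero {x ∷ ps} _ (0<x ∷ _) (x≤0 ∷ _) = contradiction x≤0 (ℕₚ.<⇒≱ 0<x)
decreasingLists-complete (suc m) {[]} _ _ _ =
  ∈-++⁺ʳ (map (suc m ∷_) (decreasingLists m)) (decreasingLists-complete m [] [] [])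
decreasingLists-complete (suc m) {x ∷ ps} (x>ps ∷ d) (0<x ∷ p) (x≤ ∷ b) with x ≟ suc m
... | yes refl = ∈-++⁺ˡ (∈-map⁺ (suc m ∷_) (decreasingLists-complete m d p (All.map ℕₚ.≤-pred x>ps)))
... | no  x≢   = ∈-++⁺ʳ (map (suc m ∷_) (decreasingLists m))
                   (decreasingLists-complete m (x>ps ∷ d) (0<x ∷ p) (x≤m ∷ All.map below x>ps))
  where
  x≤m : x ≤ m
  x≤m = ℕₚ.≤-pred (ℕₚ.≤∧≢⇒< x≤ x≢)
  below : ∀ {y} → y < x → y ≤ m
  below y<x = ℕₚ.≤-trans (ℕₚ.<⇒≤ y<x) x≤m

parts≤sum : ∀ ps → All (_≤ List.sum ps) ps
parts≤sum []       = []
parts≤sum (x ∷ ps) = ℕₚ.m≤m+n x _ ∷ All.map (λ y≤ → ℕₚ.≤-trans y≤ (ℕₚ.m≤n+m _ x)) (parts≤sum ps)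

∈-distinctPartitions : ∀ n ps → ps ∈ distinctPartitions n ⇔ IsDistinctPartition n ps
∈-distinctPartitions n ps = mk⇔ to from
  where
  to : ps ∈ distinctPartitions n → IsDistinctPartition n ps
  to ps∈ =
    let ps∈′ , Σ≡n = ∈-filter⁻ (λ ps → List.sum ps ≟ n) {xs = decreasingLists n} ps∈
        d , p , _  = decreasingLists-sound n ps∈′
    in mkDP d p Σ≡n
  from : IsDistinctPartition n ps → ps ∈ distinctPartitions n
  from (mkDP d p refl) = ∈-filter⁺ (λ ps → List.sum ps ≟ n) (decreasingLists-complete n d p (parts≤sum ps)) refl

decreasingLists-unique : ∀ m → Unique (decreasingLists m)
decreasingLists-unique zero    = [] ∷ []
decreasingLists-unique (suc m) =
  Uniqueₚ.++⁺ (Uniqueₚ.map⁺ ∷-injectiveʳ (decreasingLists-unique m)) (decreasingLists-unique m) disjoint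
  where
  disjoint : ∀ {ps} → ¬ (ps ∈ map (suc m ∷_) (decreasingLists m) × ps ∈ decreasingLists m)
  disjoint (ps∈ˡ , ps∈ʳ) with ∈-map⁻ (suc m ∷_) ps∈ˡ
  ... | _ , _ , refl with decreasingLists-sound m ps∈ʳ
  ... | _ , _ , 1+m≤m ∷ _ = ℕₚ.1+n≰n 1+m≤m

distinctPartitions-unique : ∀ n → Unique (distinctPartitions n)
distinctPartitions-unique n = Uniqueₚ.filter⁺ (λ ps → List.sum ps ≟ n) (decreasingLists-unique n)

crankSeries-summable : Summable (λ n → (+ Mₑ n -ᶻ + Mₒ n) · q^ n)
crankSeries-summable = order⇒Summable _ λ m n n≤m →
  trans (cong ((+ Mₑ (suc m) -ᶻ + Mₒ (suc m)) *ᶻ_) (q^-< n≤m)) (ℤₚ.*-zeroʳ (+ Mₑ (suc m) -ᶻ + Mₒ (suc m)))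

pentagonalSeries-summable : Summable (λ n → q^ (n * (3 * n + 1) / 2) ⊛ (𝟙 ⊖ q^ (2 * n + 1)))
pentagonalSeries-summable = order⇒Summable _ λ m n n≤m →
  sum-zero {suc n} _ λ i → cong (_*ᶻ (𝟙 ⊖ q^ (2 * suc m + 1)) (n ∸ toℕ i))
    (q^-< (ℕₚ.≤-<-trans (ℕₚ.≤-pred (toℕ<n i)) (ℕₚ.<-≤-trans n≤m (exponent≥ m))))
  where
  open import Data.Fin.Properties using (toℕ<n)
  exponent≥ : ∀ m → suc m ≤ suc m * (3 * suc m + 1) / 2
  exponent≥ m = subst (_≤ suc m * (3 * suc m + 1) / 2) (DivMod.m*n/n≡m (suc m) 2)
    (DivMod./-monoˡ-≤ 2 (ℕₚ.*-monoʳ-≤ (suc m) (ℕₚ.+-monoˡ-≤ 1 {1} {3 * suc m} (s≤s z≤n))))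

{-# OPTIONS --safe #-}
module Submission where

-- A partition into distinct parts containing 1 has sign (−1)^length, and these contribute
-- −q(q²;q)_∞.  Those without 1, sorted by largest part N, contribute
-- β = ∑_{N≥2} (−1)^N q^N ∏_{2≤j<N} (1+q^j), so (1+q)β = ∑_{N≥2} (−1)^N q^N ∏_{1≤j<N} (1+q^j).
-- Euler's series S(x) = 1 − ∑_{N≥1} x^{N+1} q^N ∏_{1≤j<N} (1−xq^j) satisfies
-- S(x) = 1 − x²q − x³q² S(xq); iterating this from x = −1 evaluates (1+q)β.

open import Defs
open import Data.Bool using (if_then_else_; true; false)
open import Data.Fin using (Fin; toℕ)
open import Data.Integer using (ℤ; +_; -_; 0ℤ; 1ℤ; -1ℤ; _-_) renaming (_+_ to _+ᶻ_; _*_ to _*ᶻ_)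
open import Data.Integer.Divisibility.Signed using (_∣?_; ∣-refl; ∣m∣n⇒∣m+n; ∣m+n∣m⇒∣n)
import Data.Integer.Properties as ℤₚ
import Data.Integer.Tactic.RingSolver as ℤ-Solver
open import Data.List using (List; []; _∷_; _++_; map; filter; foldr; length)
open import Data.List.Membership.Propositional using (_∈_)
open import Data.List.Relation.Unary.All using (All; []; _∷_)
open import Data.List.Relation.Unary.Any using (here; there)
import Data.Nat.ListAction as List using (sum)
open import Data.Nat using (ℕ; zero; suc; _+_; _*_; _∸_; _/_; _≤_; _<_; _⊔_; _≟_; z≤n; s≤s)
open import Data.List.Membership.DecPropositional _≟_ using (_∈?_)
import Data.Nat.DivMod as DivMod
import Data.Nat.Properties as ℕₚ
import Data.Nat.Tactic.RingSolver as ℕ-Solver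
open import Data.Product using (proj₂)
open import Function using (_∘_; mk⇔)
open import Level using (0ℓ)
open import Relation.Binary.PropositionalEquality
open import Relation.Nullary using (does; ¬?)
open import Relation.Nullary.Decidable using (does-⇔)
open import Relation.Unary using (Pred; Decidable)
import Algebra.Properties.AbelianGroup
import Algebra.Properties.Monoid.Sum
open Algebra.Properties.Monoid.Sum ℤₚ.+-0-monoid using (sum; sum-cong-≗)
open Algebra.Properties.AbelianGroup ℤₚ.+-0-abelianGroup using (∙-cancelˡ; ∙-cancelʳ)

open ≡-Reasoning

-- Multiplication by powers of q

shift : ℕ → Series → Series
shift zero    f n       = f n
shift (suc k) f zero    = 0ℤ
shift (suc k) f (suc n) = shift k f n

shift-cong : ∀ k {f g} → f ≈ g → shift k f ≈ shift k g
shift-cong zero    f≈g n       = f≈g n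
shift-cong (suc k) f≈g zero    = refl
shift-cong (suc k) f≈g (suc n) = shift-cong k f≈g n

shift-⊕ : ∀ k f g → shift k (f ⊕ g) ≈ shift k f ⊕ shift k g
shift-⊕ zero    f g n       = refl
shift-⊕ (suc k) f g zero    = refl
shift-⊕ (suc k) f g (suc n) = shift-⊕ k f g n

shift-⊖ : ∀ k f g → shift k (f ⊖ g) ≈ shift k f ⊖ shift k g
shift-⊖ zero    f g n       = refl
shift-⊖ (suc k) f g zero    = refl
shift-⊖ (suc k) f g (suc n) = shift-⊖ k f g n

shift-· : ∀ k c f → shift k (c · f) ≈ c · shift k f
shift-· zero    c f n       = refl
shift-· (suc k) c f zero    = sym (ℤₚ.*-zeroʳ c)
shift-· (suc k) c f (suc n) = shift-· k c f n

shift-shift : ∀ j k f → shift j (shift k f) ≈ shift (j + k) f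
shift-shift zero    k f n       = refl
shift-shift (suc j) k f zero    = refl
shift-shift (suc j) k f (suc n) = shift-shift j k f n

shift-comm : ∀ j k f → shift j (shift k f) ≈ shift k (shift j f)
shift-comm j k f n = begin
  shift j (shift k f) n ≡⟨ shift-shift j k f n ⟩
  shift (j + k) f n     ≡⟨ cong (λ i → shift i f n) (ℕₚ.+-comm j k) ⟩
  shift (k + j) f n     ≡⟨ shift-shift k j f n ⟨
  shift k (shift j f) n ∎

shift-low : ∀ {k n} f → n < k → shift k f n ≡ 0ℤ
shift-low {suc k} {zero}  f _         = refl
shift-low {suc k} {suc n} f (s≤s n<k) = shift-low f n<k

shift-𝟘 : ∀ k → shift k 𝟘 ≈ 𝟘
shift-𝟘 zero    n       = refl
shift-𝟘 (suc k) zero    = refl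
shift-𝟘 (suc k) (suc n) = shift-𝟘 k n

shift-q^ : ∀ j k → shift j (q^ k) ≈ q^ (j + k)
shift-q^ zero    k n       = refl
shift-q^ (suc j) k zero    = refl
shift-q^ (suc j) k (suc n) = shift-q^ j k n

q^≈shift : ∀ k → q^ k ≈ shift k 𝟙
q^≈shift k n = trans (cong (λ j → (q^ j) n) (sym (ℕₚ.+-identityʳ k))) (sym (shift-q^ k 0 n))

-- The bridge from convolutions to `shift`, on which the rest of the proof computes. At `suc k` and
-- `suc n` the leading product is 0 and the remaining sum is definitionally the convolution with
-- `q^ k` in degree `n`.
q^-⊛ : ∀ k f → q^ k ⊛ f ≈ shift k f
q^-⊛ zero    f n       = ⊛-unit 𝟙 f n λ _ _ → refl
q^-⊛ (suc k) f zero    = refl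
q^-⊛ (suc k) f (suc n) = trans (ℤₚ.+-identityˡ _) (q^-⊛ k f n)

-- Differences of series and division by `1 + q`.

sum-sub : ∀ {n} (f g : Fin n → ℤ) → sum (λ i → f i - g i) ≡ sum f - sum g
sum-sub {zero}  f g = refl
sum-sub {suc n} f g = trans (cong (f Fin.zero - g Fin.zero +ᶻ_) (sum-sub (f ∘ Fin.suc) (g ∘ Fin.suc)))
                            (interchange (f Fin.zero) (g Fin.zero) (sum (f ∘ Fin.suc)) (sum (g ∘ Fin.suc)))
  where
  interchange : ∀ a b c d → a - b +ᶻ (c - d) ≡ a +ᶻ c - (b +ᶻ d)
  interchange = ℤ-Solver.solve-∀

⊛-distribʳ-⊖ : ∀ f g h → (f ⊖ g) ⊛ h ≈ f ⊛ h ⊖ g ⊛ h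
⊛-distribʳ-⊖ f g h n = trans
  (sum-cong-≗ {suc n} λ i → distrib (f (toℕ i)) (g (toℕ i)) (h (n ∸ toℕ i)))
  (sum-sub {suc n} (λ i → f (toℕ i) *ᶻ h (n ∸ toℕ i)) (λ i → g (toℕ i) *ᶻ h (n ∸ toℕ i)))
  where
  distrib : ∀ a b c → (a - b) *ᶻ c ≡ a *ᶻ c - b *ᶻ c
  distrib = ℤ-Solver.solve-∀

⊛-congˡ : ∀ {f g} h → f ≈ g → f ⊛ h ≈ g ⊛ h
⊛-congˡ h f≈g n = sum-cong-≗ {suc n} λ i → cong (_*ᶻ h (n ∸ toℕ i)) (f≈g (toℕ i))

-- The coefficients of the reciprocal alternate in sign, so in degree `suc n` the convolution is
-- `f (suc n)` minus its own value in degree `n`. Reading this off directly avoids associativity of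
-- `⊛`.
recip-1+q : ∀ f n → let r = recip (𝟙 ⊕ q^ 1) 1+q-invertible ⊛ f in r n +ᶻ shift 1 r n ≡ f n
recip-1+q f zero = identity (f 0)
  where
  identity : ∀ a → 1ℤ *ᶻ a +ᶻ 0ℤ +ᶻ 0ℤ ≡ a
  identity = ℤ-Solver.solve-∀
recip-1+q f (suc n) = begin
  1ℤ *ᶻ f (suc n) +ᶻ sum {suc n} (λ i → - alt (toℕ i) *ᶻ f (n ∸ toℕ i)) +ᶻ r
    ≡⟨ cong (λ x → 1ℤ *ᶻ f (suc n) +ᶻ x +ᶻ r) negated ⟩
  1ℤ *ᶻ f (suc n) +ᶻ (0ℤ - r) +ᶻ r
    ≡⟨ cancel (f (suc n)) r ⟩
  f (suc n) ∎
  where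
  alt = recip (𝟙 ⊕ q^ 1) 1+q-invertible
  r = (alt ⊛ f) n
  cancel : ∀ a b → 1ℤ *ᶻ a +ᶻ (0ℤ - b) +ᶻ b ≡ a
  cancel = ℤ-Solver.solve-∀
  neg-* : ∀ a b → - a *ᶻ b ≡ 0ℤ - a *ᶻ b
  neg-* = ℤ-Solver.solve-∀
  negated : sum {suc n} (λ i → - alt (toℕ i) *ᶻ f (n ∸ toℕ i)) ≡ 0ℤ - r
  negated = begin
    sum {suc n} (λ i → - alt (toℕ i) *ᶻ f (n ∸ toℕ i))
      ≡⟨ sum-cong-≗ {suc n} (λ i → neg-* (alt (toℕ i)) (f (n ∸ toℕ i))) ⟩
    sum {suc n} (λ i → 0ℤ - alt (toℕ i) *ᶻ f (n ∸ toℕ i))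
      ≡⟨ sum-sub {suc n} (λ _ → 0ℤ) (λ i → alt (toℕ i) *ᶻ f (n ∸ toℕ i)) ⟩
    sum {suc n} (λ _ → 0ℤ) - r
      ≡⟨ cong (_- r) (sum-zero {suc n} (λ _ → 0ℤ) λ _ → refl) ⟩
    0ℤ - r ∎

-- Euler's recursion at x = −q^k

σ : ℕ → ℤ
σ zero    = 1ℤ
σ (suc n) = - σ n

-- ∏⁺ k N = (1 + q^(k+1)) ⋯ (1 + q^(k+N)).
∏⁺ : ℕ → ℕ → Series
∏⁺ k zero    = 𝟙
∏⁺ k (suc N) = ∏⁺ k N ⊕ shift (k + suc N) (∏⁺ k N)

-- The definition splits off the last factor; here the first one goes, which raises `k`. This serves
-- the passage from x to xq in Euler's recursion, and multiplication by `1 + q` of products that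
-- start at `1 + q²`.
∏⁺-first : ∀ k N → ∏⁺ k (suc N) ≈ ∏⁺ (suc k) N ⊕ shift (suc k) (∏⁺ (suc k) N)
∏⁺-first k zero n = cong (λ j → 𝟙 n +ᶻ shift j 𝟙 n) (ℕₚ.+-comm k 1)
∏⁺-first k (suc N) n = begin
  ∏⁺ k (suc N) n +ᶻ shift (k + suc (suc N)) (∏⁺ k (suc N)) n
    ≡⟨ cong₂ _+ᶻ_ (∏⁺-first k N n) (cong (λ j → shift j (∏⁺ k (suc N)) n) (ℕₚ.+-suc k (suc N))) ⟩
  A n +ᶻ shift (suc k) A n +ᶻ shift j (∏⁺ k (suc N)) n
    ≡⟨ cong (A n +ᶻ shift (suc k) A n +ᶻ_)
         (trans (shift-cong j (∏⁺-first k N) n) (shift-⊕ j A (shift (suc k) A) n)) ⟩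
  A n +ᶻ shift (suc k) A n +ᶻ (shift j A n +ᶻ shift j (shift (suc k) A) n)
    ≡⟨ cong (λ x → A n +ᶻ shift (suc k) A n +ᶻ (shift j A n +ᶻ x)) (shift-comm j (suc k) A n) ⟩
  A n +ᶻ shift (suc k) A n +ᶻ (shift j A n +ᶻ shift (suc k) (shift j A) n)
    ≡⟨ interchange (A n) _ _ _ ⟩
  A n +ᶻ shift j A n +ᶻ (shift (suc k) A n +ᶻ shift (suc k) (shift j A) n)
    ≡⟨ cong (A n +ᶻ shift j A n +ᶻ_) (shift-⊕ (suc k) A (shift j A) n) ⟨
  A n +ᶻ shift j A n +ᶻ shift (suc k) (A ⊕ shift j A) n ∎
  where
  A = ∏⁺ (suc k) N
  j = suc k + suc N
  interchange : ∀ a b c d → a +ᶻ b +ᶻ (c +ᶻ d) ≡ a +ᶻ c +ᶻ (b +ᶻ d)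
  interchange = ℤ-Solver.solve-∀

-- eulerSum k M is S(−q^k), truncated to N ≤ M.
eulerSum : ℕ → ℕ → Series
eulerSum k zero    = 𝟙
eulerSum k (suc M) = eulerSum k M ⊖ σ M · shift (k * (2 + M) + suc M) (∏⁺ k M)

-- The error of Euler's recursion for truncated sums. Its order is at least `3 + M`, so it
-- disappears in any fixed degree once `M` is large.
eulerRest : ℕ → ℕ → Series
eulerRest k M = σ M · shift (k * (4 + M) + (3 + M)) (∏⁺ (suc k) M)

-- The relation S(x) = 1 - x²q - x³q² S(xq) at x = -q^k, made exact for truncations. Induction on
-- `M`: the product in each new term of the left side is rewritten by `∏⁺-first` over `suc k`, after
-- which the errors telescope.
eulerSum-rec : ∀ k M → eulerSum k (2 + M) ≈
  𝟙 ⊖ q^ (2 * k + 1) ⊕ shift (3 * k + 2) (eulerSum (suc k) M) ⊕ eulerRest k M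
eulerSum-rec k zero n = begin
  𝟙 n - 1ℤ *ᶻ shift (k * 2 + 1) 𝟙 n - - 1ℤ *ᶻ shift (k * 3 + 2) (∏⁺ k 1) n
    ≡⟨ cong₂ (λ x y → 𝟙 n - 1ℤ *ᶻ x - - 1ℤ *ᶻ y)
         (trans (cong (λ j → shift (j + 1) 𝟙 n) (ℕₚ.*-comm k 2)) (sym (q^≈shift (2 * k + 1) n)))
         (trans (cong (λ j → shift (j + 2) (∏⁺ k 1) n) (ℕₚ.*-comm k 3))
                (shift-⊕ (3 * k + 2) 𝟙 (shift (k + 1) 𝟙) n)) ⟩
  𝟙 n - 1ℤ *ᶻ (q^ (2 * k + 1)) n
    - - 1ℤ *ᶻ (shift (3 * k + 2) 𝟙 n +ᶻ shift (3 * k + 2) (shift (k + 1) 𝟙) n)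
    ≡⟨ cong (λ x → 𝟙 n - 1ℤ *ᶻ (q^ (2 * k + 1)) n - - 1ℤ *ᶻ (shift (3 * k + 2) 𝟙 n +ᶻ x))
         (trans (shift-shift (3 * k + 2) (k + 1) 𝟙 n) (cong (λ j → shift j 𝟙 n) (exponent k))) ⟩
  𝟙 n - 1ℤ *ᶻ (q^ (2 * k + 1)) n - - 1ℤ *ᶻ (shift (3 * k + 2) 𝟙 n +ᶻ shift (k * 4 + 3) 𝟙 n)
    ≡⟨ rearrange (𝟙 n) _ _ _ ⟩
  𝟙 n - (q^ (2 * k + 1)) n +ᶻ shift (3 * k + 2) 𝟙 n +ᶻ 1ℤ *ᶻ shift (k * 4 + 3) 𝟙 n ∎
  where
  exponent : ∀ k → 3 * k + 2 + (k + 1) ≡ k * 4 + 3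
  exponent = ℕ-Solver.solve-∀
  rearrange : ∀ a b c d → a - 1ℤ *ᶻ b - - 1ℤ *ᶻ (c +ᶻ d) ≡ a - b +ᶻ c +ᶻ 1ℤ *ᶻ d
  rearrange = ℤ-Solver.solve-∀
eulerSum-rec k (suc M) n = begin
  eulerSum k (2 + M) n - - - s *ᶻ shift a (∏⁺ k (2 + M)) n
    ≡⟨ cong₂ (λ x y → x - - - s *ᶻ y) (eulerSum-rec k M n) expanded ⟩
  u +ᶻ shift b (eulerSum (suc k) M) n +ᶻ s *ᶻ x - - - s *ᶻ (x +ᶻ y +ᶻ z)
    ≡⟨ rearrange u (shift b (eulerSum (suc k) M) n) s x y z ⟩
  u +ᶻ (shift b (eulerSum (suc k) M) n - s *ᶻ y) +ᶻ - s *ᶻ z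
    ≡⟨ cong (λ w → u +ᶻ w +ᶻ - s *ᶻ z) collected ⟨
  u +ᶻ shift b (eulerSum (suc k) (suc M)) n +ᶻ - s *ᶻ z ∎
  where
  s = σ M
  A = ∏⁺ (suc k) M
  A⁺ = ∏⁺ (suc k) (suc M)
  a = k * (4 + M) + (3 + M)
  b = 3 * k + 2
  c = suc k * (2 + M) + suc M
  u = 𝟙 n - (q^ (2 * k + 1)) n
  -- The new term on the left consists of `x`, which cancels the old error, `y`, which extends
  -- `eulerSum (suc k) M` by one term, and `z`, which is the new error.
  x = shift a A n
  y = shift (b + c) A n
  z = shift (k * (5 + M) + (4 + M)) A⁺ n
  exponent₁ : ∀ k M → k * (4 + M) + (3 + M) + (suc k + suc M) ≡ 3 * k + 2 + (suc k * (2 + M) + suc M)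
  exponent₁ = ℕ-Solver.solve-∀
  exponent₂ : ∀ k M → k * (4 + M) + (3 + M) + suc k ≡ k * (5 + M) + (4 + M)
  exponent₂ = ℕ-Solver.solve-∀
  expanded : shift a (∏⁺ k (2 + M)) n ≡ x +ᶻ y +ᶻ z
  expanded = begin
    shift a (∏⁺ k (2 + M)) n
      ≡⟨ shift-cong a (∏⁺-first k (suc M)) n ⟩
    shift a (A⁺ ⊕ shift (suc k) A⁺) n
      ≡⟨ shift-⊕ a A⁺ (shift (suc k) A⁺) n ⟩
    shift a A⁺ n +ᶻ shift a (shift (suc k) A⁺) n
      ≡⟨ cong₂ _+ᶻ_ (shift-⊕ a A (shift (suc k + suc M) A) n) (shift-shift a (suc k) A⁺ n) ⟩
    x +ᶻ shift a (shift (suc k + suc M) A) n +ᶻ shift (a + suc k) A⁺ n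
      ≡⟨ cong₂ (λ v w → x +ᶻ v +ᶻ w)
           (trans (shift-shift a (suc k + suc M) A n) (cong (λ j → shift j A n) (exponent₁ k M)))
           (cong (λ j → shift j A⁺ n) (exponent₂ k M)) ⟩
    x +ᶻ y +ᶻ z ∎
  collected : shift b (eulerSum (suc k) (suc M)) n ≡ shift b (eulerSum (suc k) M) n - s *ᶻ y
  collected = begin
    shift b (eulerSum (suc k) M ⊖ s · shift c A) n
      ≡⟨ shift-⊖ b (eulerSum (suc k) M) (s · shift c A) n ⟩
    shift b (eulerSum (suc k) M) n - shift b (s · shift c A) n
      ≡⟨ cong (λ w → shift b (eulerSum (suc k) M) n - w)
           (trans (shift-· b s (shift c A) n) (cong (s *ᶻ_) (shift-shift b c A n))) ⟩
    shift b (eulerSum (suc k) M) n - s *ᶻ y ∎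
  rearrange : ∀ u v s x y z →
    u +ᶻ v +ᶻ s *ᶻ x - - - s *ᶻ (x +ᶻ y +ᶻ z) ≡ u +ᶻ (v - s *ᶻ y) +ᶻ - s *ᶻ z
  rearrange = ℤ-Solver.solve-∀

-- The pentagonal sum

-- Accumulates the exponents `3 * k + 2` picked up by successive uses of `eulerSum-rec`.
pentagonal : ℕ → ℕ
pentagonal zero    = 0
pentagonal (suc k) = pentagonal k + (3 * k + 2)

pentagonal-formula : ∀ n → n * (3 * n + 1) / 2 ≡ pentagonal n
pentagonal-formula n = trans (cong (_/ 2) (doubled n)) (DivMod.m*n/n≡m (pentagonal n) 2)
  where
  step : ∀ k → suc k * (3 * suc k + 1) ≡ k * (3 * k + 1) + (3 * k + 2) * 2
  step = ℕ-Solver.solve-∀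
  -- The induction runs on the doubled values, where no division occurs.
  doubled : ∀ k → k * (3 * k + 1) ≡ pentagonal k * 2
  doubled zero    = refl
  doubled (suc k) = begin
    suc k * (3 * suc k + 1)             ≡⟨ step k ⟩
    k * (3 * k + 1) + (3 * k + 2) * 2   ≡⟨ cong (_+ (3 * k + 2) * 2) (doubled k) ⟩
    pentagonal k * 2 + (3 * k + 2) * 2  ≡⟨ ℕₚ.*-distribʳ-+ 2 (pentagonal k) (3 * k + 2) ⟨
    (pentagonal k + (3 * k + 2)) * 2    ∎

k≤pentagonal : ∀ k → k ≤ pentagonal k
k≤pentagonal zero    = z≤n
k≤pentagonal (suc k) = subst (_≤ pentagonal (suc k)) (ℕₚ.+-comm k 1)
  (ℕₚ.+-mono-≤ (k≤pentagonal k) (ℕₚ.≤-trans (s≤s z≤n) (ℕₚ.m≤n+m 2 (3 * k))))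

pentagonalTerm : ℕ → Series
pentagonalTerm n = q^ (n * (3 * n + 1) / 2) ⊛ (𝟙 ⊖ q^ (2 * n + 1))

pentagonalTerm≈shift : ∀ k → pentagonalTerm k ≈ shift (pentagonal k) (𝟙 ⊖ q^ (2 * k + 1))
pentagonalTerm≈shift k n = trans
  (cong (λ e → (q^ e ⊛ (𝟙 ⊖ q^ (2 * k + 1))) n) (pentagonal-formula k))
  (q^-⊛ (pentagonal k) (𝟙 ⊖ q^ (2 * k + 1)) n)

-- `eulerSum-rec` applied at k = 0, ..., `K`. The use at k = 0 yields `𝟙 ⊖ q^ 1`, every later one a
-- pentagonal term, and the bound on `n` keeps all errors in degrees above `n`.
eulerSum-iterate : ∀ K M n → n ≤ 2 + M → eulerSum 0 (2 * suc K + M) n ≡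
  (𝟙 ⊖ q^ 1 ⊕ ∑≤ pentagonalTerm K ⊕ shift (pentagonal (suc K)) (eulerSum (suc K) M)) n
eulerSum-iterate zero M n n≤ = begin
  eulerSum 0 (2 + M) n
    ≡⟨ eulerSum-rec 0 M n ⟩
  𝟙 n - (q^ 1) n +ᶻ shift 2 (eulerSum 1 M) n +ᶻ σ M *ᶻ shift (3 + M) (∏⁺ 1 M) n
    ≡⟨ cong (λ x → 𝟙 n - (q^ 1) n +ᶻ shift 2 (eulerSum 1 M) n +ᶻ σ M *ᶻ x)
         (shift-low (∏⁺ 1 M) (s≤s n≤)) ⟩
  𝟙 n - (q^ 1) n +ᶻ shift 2 (eulerSum 1 M) n +ᶻ σ M *ᶻ 0ℤ
    ≡⟨ rearrange (𝟙 n - (q^ 1) n) _ (σ M) ⟩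
  𝟙 n - (q^ 1) n +ᶻ 0ℤ +ᶻ shift 2 (eulerSum 1 M) n ∎
  where
  rearrange : ∀ a b s → a +ᶻ b +ᶻ s *ᶻ 0ℤ ≡ a +ᶻ 0ℤ +ᶻ b
  rearrange = ℤ-Solver.solve-∀
eulerSum-iterate (suc K) M n n≤ = begin
  eulerSum 0 (2 * suc k + M) n
    ≡⟨ cong (λ i → eulerSum 0 i n) (index k M) ⟩
  eulerSum 0 (2 * k + (2 + M)) n
    -- Each use of the recursion costs two terms of the truncation, hence `2 + M` in the induction
    -- hypothesis.
    ≡⟨ eulerSum-iterate K (2 + M) n (ℕₚ.≤-trans n≤ (ℕₚ.m≤n+m (2 + M) 2)) ⟩
  a +ᶻ ∑≤ pentagonalTerm K n +ᶻ shift p (eulerSum k (2 + M)) n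
    ≡⟨ cong (a +ᶻ ∑≤ pentagonalTerm K n +ᶻ_) unrolled ⟩
  a +ᶻ ∑≤ pentagonalTerm K n +ᶻ (pentagonalTerm k n +ᶻ shift (p + b) (eulerSum (suc k) M) n)
    ≡⟨ rearrange a _ _ _ ⟩
  a +ᶻ (∑≤ pentagonalTerm K n +ᶻ pentagonalTerm k n) +ᶻ shift (p + b) (eulerSum (suc k) M) n ∎
  where
  k = suc K
  a = 𝟙 n - (q^ 1) n
  p = pentagonal k
  b = 3 * k + 2
  main = 𝟙 ⊖ q^ (2 * k + 1)
  next = shift b (eulerSum (suc k) M)
  index : ∀ k M → 2 * suc k + M ≡ 2 * k + (2 + M)
  index = ℕ-Solver.solve-∀
  rearrange : ∀ a b c d → a +ᶻ b +ᶻ (c +ᶻ d) ≡ a +ᶻ (b +ᶻ c) +ᶻ d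
  rearrange = ℤ-Solver.solve-∀
  vanish : shift p (eulerRest k M) n ≡ 0ℤ
  vanish = begin
    shift p (σ M · shift c A) n       ≡⟨ shift-· p (σ M) (shift c A) n ⟩
    σ M *ᶻ shift p (shift c A) n      ≡⟨ cong (σ M *ᶻ_) (shift-shift p c A n) ⟩
    σ M *ᶻ shift (p + c) A n          ≡⟨ cong (σ M *ᶻ_) (shift-low A n<p+c) ⟩
    σ M *ᶻ 0ℤ                         ≡⟨ ℤₚ.*-zeroʳ (σ M) ⟩
    0ℤ                                ∎
    where
    A = ∏⁺ (suc k) M
    c = k * (4 + M) + (3 + M)
    n<p+c : n < p + c
    n<p+c = ℕₚ.≤-trans (s≤s n≤) (ℕₚ.≤-trans (ℕₚ.m≤n+m (3 + M) (k * (4 + M))) (ℕₚ.m≤n+m c p))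
  unrolled : shift p (eulerSum k (2 + M)) n ≡ pentagonalTerm k n +ᶻ shift (p + b) (eulerSum (suc k) M) n
  unrolled = begin
    shift p (eulerSum k (2 + M)) n
      ≡⟨ shift-cong p (eulerSum-rec k M) n ⟩
    shift p (main ⊕ next ⊕ eulerRest k M) n
      ≡⟨ shift-⊕ p (main ⊕ next) (eulerRest k M) n ⟩
    shift p (main ⊕ next) n +ᶻ shift p (eulerRest k M) n
      ≡⟨ cong₂ _+ᶻ_ (shift-⊕ p main next n) vanish ⟩
    shift p main n +ᶻ shift p next n +ᶻ 0ℤ
      ≡⟨ ℤₚ.+-identityʳ _ ⟩
    shift p main n +ᶻ shift p next n
      ≡⟨ cong₂ _+ᶻ_ (sym (pentagonalTerm≈shift k n)) (shift-shift p b (eulerSum (suc k) M) n) ⟩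
    pentagonalTerm k n +ᶻ shift (p + b) (eulerSum (suc k) M) n ∎

-- Partitions without the part 1

-- noOnes m is β restricted to largest parts N ≤ m + 1; the summand of index i has N = i + 2.
noOnes : ℕ → Series
noOnes zero    = 𝟘
noOnes (suc i) = noOnes i ⊕ σ i · shift (2 + i) (∏⁺ 1 i)

-- The factor `1 + q` is absorbed into each product as its missing factor for j = 1, which gives the
-- products of Euler's series at x = -1.
[1+q]noOnes : ℕ → Series
[1+q]noOnes zero    = 𝟘
[1+q]noOnes (suc i) = [1+q]noOnes i ⊕ σ i · shift (2 + i) (∏⁺ 0 (suc i))

noOnes-*[1+q] : ∀ m → noOnes m ⊕ shift 1 (noOnes m) ≈ [1+q]noOnes m
noOnes-*[1+q] zero    n = trans (ℤₚ.+-identityˡ _) (shift-𝟘 1 n)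
noOnes-*[1+q] (suc m) n = begin
  noOnes m n +ᶻ s *ᶻ shift j A n +ᶻ shift 1 (noOnes m ⊕ s · shift j A) n
    ≡⟨ cong (noOnes m n +ᶻ s *ᶻ shift j A n +ᶻ_)
         (trans (shift-⊕ 1 (noOnes m) (s · shift j A) n)
                (cong (shift 1 (noOnes m) n +ᶻ_)
                  (trans (shift-· 1 s (shift j A) n) (cong (s *ᶻ_) (shift-comm 1 j A n))))) ⟩
  noOnes m n +ᶻ s *ᶻ shift j A n +ᶻ (shift 1 (noOnes m) n +ᶻ s *ᶻ shift j (shift 1 A) n)
    ≡⟨ rearrange (noOnes m n) s _ _ _ ⟩
  noOnes m n +ᶻ shift 1 (noOnes m) n +ᶻ s *ᶻ (shift j A n +ᶻ shift j (shift 1 A) n)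
    ≡⟨ cong₂ (λ x y → x +ᶻ s *ᶻ y) (noOnes-*[1+q] m n)
         (trans (sym (shift-⊕ j A (shift 1 A) n)) (sym (shift-cong j (∏⁺-first 0 m) n))) ⟩
  [1+q]noOnes m n +ᶻ s *ᶻ shift j (∏⁺ 0 (suc m)) n ∎
  where
  s = σ m
  j = 2 + m
  A = ∏⁺ 1 m
  rearrange : ∀ a s b c d → a +ᶻ s *ᶻ b +ᶻ (c +ᶻ s *ᶻ d) ≡ a +ᶻ c +ᶻ s *ᶻ (b +ᶻ d)
  rearrange = ℤ-Solver.solve-∀

-- At x = -1 the term N = 1 of Euler's series is -q, and the terms N ≥ 2 are those of `[1+q]noOnes`.
eulerSum-0 : ∀ m → eulerSum 0 (suc m) ≈ 𝟙 ⊖ q^ 1 ⊕ [1+q]noOnes m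
eulerSum-0 zero n = trans (cong (λ x → 𝟙 n - 1ℤ *ᶻ x) (sym (q^≈shift 1 n))) (rearrange (𝟙 n) ((q^ 1) n))
  where
  rearrange : ∀ a b → a - 1ℤ *ᶻ b ≡ a - b +ᶻ 0ℤ
  rearrange = ℤ-Solver.solve-∀
eulerSum-0 (suc m) n = trans
  (cong (_- (- σ m *ᶻ shift (2 + m) (∏⁺ 0 (suc m)) n)) (eulerSum-0 m n))
  (rearrange (𝟙 n - (q^ 1) n) ([1+q]noOnes m n) (σ m) _)
  where
  rearrange : ∀ a b s x → a +ᶻ b - (- s *ᶻ x) ≡ a +ᶻ (b +ᶻ s *ᶻ x)
  rearrange = ℤ-Solver.solve-∀

[1+q]noOnes-stable : ∀ j m n → n ≤ suc m → [1+q]noOnes (j + m) n ≡ [1+q]noOnes m n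
[1+q]noOnes-stable zero    m n n≤ = refl
[1+q]noOnes-stable (suc j) m n n≤ = begin
  [1+q]noOnes (j + m) n +ᶻ σ (j + m) *ᶻ shift (2 + (j + m)) A n
    ≡⟨ cong₂ (λ x y → x +ᶻ σ (j + m) *ᶻ y) ([1+q]noOnes-stable j m n n≤)
         (shift-low A (s≤s (ℕₚ.≤-trans n≤ (s≤s (ℕₚ.m≤n+m m j))))) ⟩
  [1+q]noOnes m n +ᶻ σ (j + m) *ᶻ 0ℤ
    ≡⟨ cong ([1+q]noOnes m n +ᶻ_) (ℤₚ.*-zeroʳ (σ (j + m))) ⟩
  [1+q]noOnes m n +ᶻ 0ℤ
    ≡⟨ ℤₚ.+-identityʳ _ ⟩
  [1+q]noOnes m n ∎
  where
  A = ∏⁺ 0 (suc (j + m))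

pentagonalSeries : Series
pentagonalSeries = ∑≥1 pentagonalTerm pentagonalSeries-summable

[1+q]noOnes≡pentagonal : ∀ m n → n ≤ suc m → [1+q]noOnes m n ≡ pentagonalSeries n
[1+q]noOnes≡pentagonal m n n≤ = ∙-cancelˡ a _ _ (begin
  a +ᶻ [1+q]noOnes m n
    -- The truncation is enlarged to the length that `eulerSum-iterate` expects; the added terms
    -- start above degree `n`.
    ≡⟨ cong (a +ᶻ_) ([1+q]noOnes-stable (2 * suc K) m n n≤) ⟨
  a +ᶻ [1+q]noOnes (2 * suc K + m) n
    ≡⟨ eulerSum-0 (2 * suc K + m) n ⟨
  eulerSum 0 (suc (2 * suc K + m)) n
    ≡⟨ cong (λ i → eulerSum 0 i n) (ℕₚ.+-suc (2 * suc K) m) ⟨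
  eulerSum 0 (2 * suc K + suc m) n
    ≡⟨ eulerSum-iterate K (suc m) n (ℕₚ.≤-trans n≤ (ℕₚ.m≤n+m (suc m) 2)) ⟩
  a +ᶻ ∑≤ pentagonalTerm K n +ᶻ shift (pentagonal (suc K)) (eulerSum (suc K) (suc m)) n
    ≡⟨ cong (a +ᶻ ∑≤ pentagonalTerm K n +ᶻ_) (shift-low (eulerSum (suc K) (suc m))
         (ℕₚ.≤-trans (ℕₚ.n≤1+n K) (k≤pentagonal (suc K)))) ⟩
  a +ᶻ ∑≤ pentagonalTerm K n +ᶻ 0ℤ
    ≡⟨ ℤₚ.+-identityʳ _ ⟩
  a +ᶻ ∑≤ pentagonalTerm K n ∎)
  where
  a = 𝟙 n - (q^ 1) n
  -- The cutoff that `pentagonalSeries-summable` chooses in degree `n`, so that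
  -- `∑≤ pentagonalTerm K n` is `pentagonalSeries n` by definition.
  K = suc n

pentagonal/[1+q] : Series
pentagonal/[1+q] = recip (𝟙 ⊕ q^ 1) 1+q-invertible ⊛ pentagonalSeries

-- Multiplied by `1 + q`, both sides agree up to degree `suc m`. Equality in the preceding degree,
-- by induction, therefore gives equality in degree `n`.
noOnes≡pentagonal : ∀ m n → n ≤ suc m → noOnes m n ≡ pentagonal/[1+q] n
noOnes≡pentagonal m n n≤ = ∙-cancelʳ (shift 1 (noOnes m) n) _ _ (begin
  noOnes m n +ᶻ shift 1 (noOnes m) n  ≡⟨ noOnes-*[1+q] m n ⟩
  [1+q]noOnes m n                     ≡⟨ [1+q]noOnes≡pentagonal m n n≤ ⟩
  pentagonalSeries n                  ≡⟨ recip-1+q pentagonalSeries n ⟨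
  r n +ᶻ shift 1 r n                  ≡⟨ cong (r n +ᶻ_) (previous n n≤) ⟨
  r n +ᶻ shift 1 (noOnes m) n         ∎)
  where
  r = pentagonal/[1+q]
  previous : ∀ n → n ≤ suc m → shift 1 (noOnes m) n ≡ shift 1 r n
  previous zero    _  = refl
  previous (suc n) n< = noOnes≡pentagonal m n (ℕₚ.<⇒≤ n<)

-- Signed generating functions of lists of partitions

gf : (List ℕ → ℤ) → List (List ℕ) → Series
gf w []       = 𝟘
gf w (ps ∷ L) = w ps · q^ (List.sum ps) ⊕ gf w L

gf-cong : ∀ {w v} L → (∀ {ps} → ps ∈ L → w ps ≡ v ps) → gf w L ≈ gf v L
gf-cong []       w≡v n = refl
gf-cong (ps ∷ L) w≡v n =
  cong₂ (λ x y → x *ᶻ (q^ (List.sum ps)) n +ᶻ y) (w≡v (here refl)) (gf-cong L (w≡v ∘ there) n)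

gf-⊕ : ∀ w v L → gf (λ ps → w ps +ᶻ v ps) L ≈ gf w L ⊕ gf v L
gf-⊕ w v []       n = refl
gf-⊕ w v (ps ∷ L) n = trans
  (cong ((w ps +ᶻ v ps) *ᶻ (q^ (List.sum ps)) n +ᶻ_) (gf-⊕ w v L n))
  (rearrange (w ps) (v ps) _ _ _)
  where
  rearrange : ∀ a b x y z → (a +ᶻ b) *ᶻ x +ᶻ (y +ᶻ z) ≡ a *ᶻ x +ᶻ y +ᶻ (b *ᶻ x +ᶻ z)
  rearrange = ℤ-Solver.solve-∀

gf-· : ∀ c w L → gf (λ ps → c *ᶻ w ps) L ≈ c · gf w L
gf-· c w []       n = sym (ℤₚ.*-zeroʳ c)
gf-· c w (ps ∷ L) n = trans
  (cong (c *ᶻ w ps *ᶻ (q^ (List.sum ps)) n +ᶻ_) (gf-· c w L n))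
  (rearrange c (w ps) _ _)
  where
  rearrange : ∀ c a x y → c *ᶻ a *ᶻ x +ᶻ c *ᶻ y ≡ c *ᶻ (a *ᶻ x +ᶻ y)
  rearrange = ℤ-Solver.solve-∀

gf-++ : ∀ w K L → gf w (K ++ L) ≈ gf w K ⊕ gf w L
gf-++ w []       L n = sym (ℤₚ.+-identityˡ _)
gf-++ w (ps ∷ K) L n = trans (cong (w ps *ᶻ (q^ (List.sum ps)) n +ᶻ_) (gf-++ w K L n))
                             (sym (ℤₚ.+-assoc (w ps *ᶻ (q^ (List.sum ps)) n) (gf w K n) (gf w L n)))

gf-map-∷ : ∀ w k L → gf w (map (k ∷_) L) ≈ shift k (gf (w ∘ (k ∷_)) L)
gf-map-∷ w k []       n = sym (shift-𝟘 k n)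
gf-map-∷ w k (ps ∷ L) n = begin
  c *ᶻ (q^ (k + s)) n +ᶻ gf w (map (k ∷_) L) n
    ≡⟨ cong₂ _+ᶻ_ (trans (cong (c *ᶻ_) (sym (shift-q^ k s n))) (sym (shift-· k c (q^ s) n)))
         (gf-map-∷ w k L n) ⟩
  shift k (c · q^ s) n +ᶻ shift k (gf (w ∘ (k ∷_)) L) n
    ≡⟨ shift-⊕ k (c · q^ s) (gf (w ∘ (k ∷_)) L) n ⟨
  shift k (c · q^ s ⊕ gf (w ∘ (k ∷_)) L) n ∎
  where
  c = w (k ∷ ps)
  s = List.sum ps

gf-decreasingLists : ∀ w m → gf w (decreasingLists (suc m)) ≈
  shift (suc m) (gf (w ∘ (suc m ∷_)) (decreasingLists m)) ⊕ gf w (decreasingLists m)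
gf-decreasingLists w m n = trans
  (gf-++ w (map (suc m ∷_) (decreasingLists m)) (decreasingLists m) n)
  (cong (_+ᶻ gf w (decreasingLists m) n) (gf-map-∷ w (suc m) (decreasingLists m) n))

-- The parity sign of the crank is split by whether 1 is a part, because the two halves recurse
-- differently: the length changes with every part, the maximum only with the first. Once the
-- largest part is fixed, its tails are counted without sign by `withoutOne-indicator`.
withOne-sign withoutOne-indicator withoutOne-sign : List ℕ → ℤ
withOne-sign ps         = if does (1 ∈? ps) then σ (length ps) else 0ℤ
withoutOne-indicator ps = if does (1 ∈? ps) then 0ℤ else 1ℤ
withoutOne-sign ps      = if does (1 ∈? ps) then 0ℤ else σ (foldr _⊔_ 0 ps)

qPochFactor-⊛ : ∀ i f → qPochFactor (q^ 2) i ⊛ f ≈ f ⊖ shift (2 + i) f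
qPochFactor-⊛ i f n = begin
  ((𝟙 ⊖ q^ 2 ⊛ q^ i) ⊛ f) n
    ≡⟨ ⊛-distribʳ-⊖ 𝟙 (q^ 2 ⊛ q^ i) f n ⟩
  (𝟙 ⊛ f) n - ((q^ 2 ⊛ q^ i) ⊛ f) n
    ≡⟨ cong₂ _-_ (q^-⊛ 0 f n) (trans (⊛-congˡ f q^2⊛q^i n) (q^-⊛ (2 + i) f n)) ⟩
  f n - shift (2 + i) f n ∎
  where
  q^2⊛q^i : q^ 2 ⊛ q^ i ≈ q^ (2 + i)
  q^2⊛q^i k = trans (q^-⊛ 2 (q^ i) k) (shift-q^ 2 i k)

-- The partition (1) gives -q. Allowing the further part `2 + m` adds a copy shifted by `2 + m` with
-- reversed sign, that is, a factor 1 - q^(m+2).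
gf-withOne : ∀ m → gf withOne-sign (decreasingLists (suc m)) ≈
                   -1ℤ · shift 1 (∏< (qPochFactor (q^ 2)) m)
gf-withOne zero n = trans (rearrange ((q^ 1) n) ((q^ 0) n)) (cong (-1ℤ *ᶻ_) (q^≈shift 1 n))
  where
  rearrange : ∀ a b → -1ℤ *ᶻ a +ᶻ (0ℤ *ᶻ b +ᶻ 0ℤ) ≡ -1ℤ *ᶻ a
  rearrange = ℤ-Solver.solve-∀
gf-withOne (suc m) n = begin
  gf withOne-sign (decreasingLists (2 + m)) n
    ≡⟨ gf-decreasingLists withOne-sign (suc m) n ⟩
  shift (2 + m) (gf (withOne-sign ∘ (2 + m ∷_)) L) n +ᶻ gf withOne-sign L n
    ≡⟨ cong₂ _+ᶻ_ (shift-cong (2 + m) prepended n) (gf-withOne m n) ⟩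
  shift (2 + m) (1ℤ · shift 1 p) n +ᶻ -1ℤ *ᶻ shift 1 p n
    ≡⟨ cong (_+ᶻ -1ℤ *ᶻ shift 1 p n)
         (trans (shift-· (2 + m) 1ℤ (shift 1 p) n) (cong (1ℤ *ᶻ_) (shift-comm (2 + m) 1 p n))) ⟩
  1ℤ *ᶻ shift 1 (shift (2 + m) p) n +ᶻ -1ℤ *ᶻ shift 1 p n
    ≡⟨ rearrange₂ (shift 1 p n) (shift 1 (shift (2 + m) p) n) ⟩
  -1ℤ *ᶻ (shift 1 p n - shift 1 (shift (2 + m) p) n)
    ≡⟨ cong (-1ℤ *ᶻ_) (trans (shift-cong 1 (qPochFactor-⊛ m p) n) (shift-⊖ 1 p (shift (2 + m) p) n)) ⟨
  -1ℤ *ᶻ shift 1 (qPochFactor (q^ 2) m ⊛ p) n ∎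
  where
  L = decreasingLists (suc m)
  p = ∏< (qPochFactor (q^ 2)) m
  negate : ∀ ps → withOne-sign (2 + m ∷ ps) ≡ -1ℤ *ᶻ withOne-sign ps
  -- `1 ≟ 2 + m` evaluates to false, so membership in `2 + m ∷ ps` reduces to membership in `ps`.
  negate ps with does (1 ∈? ps)
  ... | true  = sym (ℤₚ.-1*i≡-i (σ (length ps)))
  ... | false = refl
  rearrange₁ : ∀ a → -1ℤ *ᶻ (-1ℤ *ᶻ a) ≡ 1ℤ *ᶻ a
  rearrange₁ = ℤ-Solver.solve-∀
  rearrange₂ : ∀ a b → 1ℤ *ᶻ b +ᶻ -1ℤ *ᶻ a ≡ -1ℤ *ᶻ (a - b)
  rearrange₂ = ℤ-Solver.solve-∀
  prepended : gf (withOne-sign ∘ (2 + m ∷_)) L ≈ 1ℤ · shift 1 p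
  prepended k = begin
    gf (withOne-sign ∘ (2 + m ∷_)) L k         ≡⟨ gf-cong L (λ {ps} _ → negate ps) k ⟩
    gf (λ ps → -1ℤ *ᶻ withOne-sign ps) L k     ≡⟨ gf-· -1ℤ withOne-sign L k ⟩
    -1ℤ *ᶻ gf withOne-sign L k                 ≡⟨ cong (-1ℤ *ᶻ_) (gf-withOne m k) ⟩
    -1ℤ *ᶻ (-1ℤ *ᶻ shift 1 p k)                ≡⟨ rearrange₁ (shift 1 p k) ⟩
    1ℤ *ᶻ shift 1 p k                          ∎

gf-withoutOne-indicator : ∀ m → gf withoutOne-indicator (decreasingLists (suc m)) ≈ ∏⁺ 1 m
gf-withoutOne-indicator zero n = rearrange ((q^ 1) n) (𝟙 n)
  where
  rearrange : ∀ a b → 0ℤ *ᶻ a +ᶻ (1ℤ *ᶻ b +ᶻ 0ℤ) ≡ b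
  rearrange = ℤ-Solver.solve-∀
gf-withoutOne-indicator (suc m) n = begin
  gf withoutOne-indicator (decreasingLists (2 + m)) n
    ≡⟨ gf-decreasingLists withoutOne-indicator (suc m) n ⟩
  shift (2 + m) (gf withoutOne-indicator (decreasingLists (suc m))) n
    +ᶻ gf withoutOne-indicator (decreasingLists (suc m)) n
    ≡⟨ cong₂ _+ᶻ_ (shift-cong (2 + m) (gf-withoutOne-indicator m) n) (gf-withoutOne-indicator m n) ⟩
  shift (2 + m) (∏⁺ 1 m) n +ᶻ ∏⁺ 1 m n
    ≡⟨ ℤₚ.+-comm (shift (2 + m) (∏⁺ 1 m) n) (∏⁺ 1 m n) ⟩
  ∏⁺ 1 m n +ᶻ shift (2 + m) (∏⁺ 1 m) n ∎

foldr-⊔≤ : ∀ {m ps} → All (_≤ m) ps → foldr _⊔_ 0 ps ≤ m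
foldr-⊔≤ []         = z≤n
foldr-⊔≤ (p≤m ∷ ps≤m) = ℕₚ.⊔-lub p≤m (foldr-⊔≤ ps≤m)

-- The summand 𝟙 is the empty partition.
gf-withoutOne : ∀ m → gf withoutOne-sign (decreasingLists (suc m)) ≈ 𝟙 ⊕ noOnes m
gf-withoutOne zero n = rearrange ((q^ 1) n) (𝟙 n)
  where
  rearrange : ∀ a b → 0ℤ *ᶻ a +ᶻ (1ℤ *ᶻ b +ᶻ 0ℤ) ≡ b +ᶻ 0ℤ
  rearrange = ℤ-Solver.solve-∀
gf-withoutOne (suc m) n = begin
  gf withoutOne-sign (decreasingLists (2 + m)) n
    ≡⟨ gf-decreasingLists withoutOne-sign (suc m) n ⟩
  shift (2 + m) (gf (withoutOne-sign ∘ (2 + m ∷_)) L) n +ᶻ gf withoutOne-sign L n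
    ≡⟨ cong₂ _+ᶻ_ (trans (shift-cong (2 + m) prepended n) (shift-· (2 + m) (σ m) (∏⁺ 1 m) n))
         (gf-withoutOne m n) ⟩
  σ m *ᶻ shift (2 + m) (∏⁺ 1 m) n +ᶻ (𝟙 n +ᶻ noOnes m n)
    ≡⟨ rearrange (σ m *ᶻ shift (2 + m) (∏⁺ 1 m) n) (𝟙 n) (noOnes m n) ⟩
  𝟙 n +ᶻ (noOnes m n +ᶻ σ m *ᶻ shift (2 + m) (∏⁺ 1 m) n) ∎
  where
  L = decreasingLists (suc m)
  rearrange : ∀ a b c → a +ᶻ (b +ᶻ c) ≡ b +ᶻ (c +ᶻ a)
  rearrange = ℤ-Solver.solve-∀
  -- Entries of `ps` are at most `suc m`, so the maximum is `2 + m`, whose sign is that of `m`.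
  largest : ∀ {ps} → ps ∈ L → withoutOne-sign (2 + m ∷ ps) ≡ σ m *ᶻ withoutOne-indicator ps
  largest {ps} ps∈ with does (1 ∈? ps)
  ... | true  = sym (ℤₚ.*-zeroʳ (σ m))
  ... | false = begin
    σ ((2 + m) ⊔ foldr _⊔_ 0 ps)
      ≡⟨ cong σ (ℕₚ.m≥n⇒m⊔n≡m (ℕₚ.m≤n⇒m≤1+n (foldr-⊔≤ (proj₂ (proj₂ (decreasingLists-sound (suc m) ps∈)))))) ⟩
    - - σ m     ≡⟨ ℤₚ.neg-involutive (σ m) ⟩
    σ m         ≡⟨ ℤₚ.*-identityʳ (σ m) ⟨
    σ m *ᶻ 1ℤ   ∎
  prepended : gf (withoutOne-sign ∘ (2 + m ∷_)) L ≈ σ m · ∏⁺ 1 m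
  prepended k = begin
    gf (withoutOne-sign ∘ (2 + m ∷_)) L k            ≡⟨ gf-cong L largest k ⟩
    gf (λ ps → σ m *ᶻ withoutOne-indicator ps) L k   ≡⟨ gf-· (σ m) withoutOne-indicator L k ⟩
    σ m *ᶻ gf withoutOne-indicator L k               ≡⟨ cong (σ m *ᶻ_) (gf-withoutOne-indicator m k) ⟩
    σ m *ᶻ ∏⁺ 1 m k                                  ∎

-- Parity of the crank

paritySign : ℤ → ℤ
paritySign i = if does (+ 2 ∣? i) then 1ℤ else -1ℤ

paritySign-2+ : ∀ i → paritySign (+ 2 +ᶻ i) ≡ paritySign i
paritySign-2+ i = cong (if_then 1ℤ else -1ℤ)
  (does-⇔ (mk⇔ (λ 2∣ → ∣m+n∣m⇒∣n 2∣ ∣-refl) (∣m∣n⇒∣m+n ∣-refl)) (+ 2 ∣? (+ 2 +ᶻ i)) (+ 2 ∣? i))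

paritySign-+ : ∀ n → paritySign (+ n) ≡ σ n
paritySign-+ zero          = refl
paritySign-+ (suc zero)    = refl
paritySign-+ (suc (suc n)) = begin
  paritySign (+ (2 + n))   ≡⟨ paritySign-2+ (+ n) ⟩
  paritySign (+ n)         ≡⟨ paritySign-+ n ⟩
  σ n                      ≡⟨ ℤₚ.neg-involutive (σ n) ⟨
  - - σ n                  ∎

paritySign-crank : ∀ ps → paritySign (crank ps) ≡ withOne-sign ps +ᶻ withoutOne-sign ps
paritySign-crank ps with does (1 ∈? ps)
... | true  = begin
  -- For the partition (1) this crank is -1; adding 2 brings the argument back to a natural number,
  -- as `paritySign-+` needs.
  paritySign (+ length ps - + 2)           ≡⟨ paritySign-2+ (+ length ps - + 2) ⟨
  paritySign (+ 2 +ᶻ (+ length ps - + 2))  ≡⟨ cong paritySign (cancel (+ length ps)) ⟩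
  paritySign (+ length ps)                 ≡⟨ paritySign-+ (length ps) ⟩
  σ (length ps)                            ≡⟨ ℤₚ.+-identityʳ _ ⟨
  σ (length ps) +ᶻ 0ℤ                      ∎
  where
  cancel : ∀ a → + 2 +ᶻ (a - + 2) ≡ a
  cancel = ℤ-Solver.solve-∀
... | false = trans (paritySign-+ (foldr _⊔_ 0 ps)) (sym (ℤₚ.+-identityˡ _))

-- The coefficient of `q^ (List.sum ps)` in degree `n` performs the same test as the filter, so one
-- case split decides both, and each surviving `ps` counts 1 or -1.
count-difference : ∀ {P : Pred (List ℕ) 0ℓ} (P? : Decidable P) n L →
  let L′ = filter (λ ps → List.sum ps ≟ n) L in
  + length (filter P? L′) - + length (filter (¬? ∘ P?) L′) ≡
  gf (λ ps → if does (P? ps) then 1ℤ else -1ℤ) L n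
count-difference P? n []       = refl
count-difference P? n (ps ∷ L) with does (List.sum ps ≟ n)
... | false = trans (count-difference P? n L) (sym (trans
  (cong (_+ᶻ gf sign L n) (ℤₚ.*-zeroʳ (sign ps))) (ℤₚ.+-identityˡ _)))
  where
  sign : List ℕ → ℤ
  sign ps = if does (P? ps) then 1ℤ else -1ℤ
... | true with does (P? ps)
...   | true  = trans (extract (+ length (filter P? L′)) (+ length (filter (¬? ∘ P?) L′)))
                      (cong (1ℤ +ᶻ_) (count-difference P? n L))
  where
  L′ = filter (λ ps → List.sum ps ≟ n) L
  extract : ∀ a b → 1ℤ +ᶻ a - b ≡ 1ℤ +ᶻ (a - b)
  extract = ℤ-Solver.solve-∀
...   | false = trans (extract (+ length (filter P? L′)) (+ length (filter (¬? ∘ P?) L′)))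
                      (cong (-1ℤ +ᶻ_) (count-difference P? n L))
  where
  L′ = filter (λ ps → List.sum ps ≟ n) L
  extract : ∀ a b → a - (1ℤ +ᶻ b) ≡ -1ℤ +ᶻ (a - b)
  extract = ℤ-Solver.solve-∀

-- Coefficients of the crank series and the final comparison.

∑≤-coefficients-low : ∀ (c : ℕ → ℤ) m n → m < n → ∑≤ (λ k → c k · q^ k) m n ≡ 0ℤ
∑≤-coefficients-low c zero    n m<n = refl
∑≤-coefficients-low c (suc m) n m<n = cong₂ _+ᶻ_
  (∑≤-coefficients-low c m n (ℕₚ.<-trans (ℕₚ.n<1+n m) m<n))
  (trans (cong (c (suc m) *ᶻ_) (q^-≢ (ℕₚ.<⇒≢ m<n))) (ℤₚ.*-zeroʳ (c (suc m))))

q^-diagonal : ∀ n → (q^ n) n ≡ 1ℤ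
q^-diagonal zero    = refl
q^-diagonal (suc n) = q^-diagonal n

-- `2 + n` is the cutoff of the limit in degree `suc n`; the extra term of index `2 + n` vanishes
-- there.
∑≤-coefficients : ∀ (c : ℕ → ℤ) n → ∑≤ (λ k → c k · q^ k) (2 + n) (suc n) ≡ c (suc n)
∑≤-coefficients c n = begin
  ∑≤ (λ k → c k · q^ k) n (suc n) +ᶻ c (suc n) *ᶻ (q^ n) n +ᶻ c (2 + n) *ᶻ (q^ (suc n)) n
    ≡⟨ cong₂ _+ᶻ_
         (cong₂ (λ x y → x +ᶻ c (suc n) *ᶻ y) (∑≤-coefficients-low c n (suc n) ℕₚ.≤-refl) (q^-diagonal n))
         (cong (c (2 + n) *ᶻ_) (q^-< (ℕₚ.n<1+n n))) ⟩
  0ℤ +ᶻ c (suc n) *ᶻ 1ℤ +ᶻ c (2 + n) *ᶻ 0ℤ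
    ≡⟨ simplify (c (suc n)) (c (2 + n)) ⟩
  c (suc n) ∎
  where
  simplify : ∀ a b → 0ℤ +ᶻ a *ᶻ 1ℤ +ᶻ b *ᶻ 0ℤ ≡ a
  simplify = ℤ-Solver.solve-∀

theorem5p1 : ∑≥1 (λ n → (+ Mₑ n - + Mₒ n) · q^ n) crankSeries-summable
    ≈ recip (𝟙 ⊕ q^ 1) 1+q-invertible
    ⊛ ∑≥1 (λ n → q^ (n * (3 * n + 1) / 2) ⊛ (𝟙 ⊖ q^ (2 * n + 1))) pentagonalSeries-summable
    ⊖ q^ 1 ⊛ ⟨ q^ 2 ⨾q⟩∞
theorem5p1 zero = begin
  0ℤ +ᶻ (+ Mₑ 1 - + Mₒ 1) *ᶻ 0ℤ            ≡⟨⟩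
  0ℤ                                       ≡⟨ noOnes≡pentagonal 0 0 z≤n ⟩
  pentagonal/[1+q] 0                       ≡⟨ ℤₚ.+-identityʳ _ ⟨
  pentagonal/[1+q] 0 +ᶻ 0ℤ                 ∎
theorem5p1 (suc n) = begin
  ∑≤ (λ k → (+ Mₑ k - + Mₒ k) · q^ k) (2 + n) (suc n)
    ≡⟨ ∑≤-coefficients (λ k → + Mₑ k - + Mₒ k) n ⟩
  + Mₑ (suc n) - + Mₒ (suc n)
    ≡⟨ count-difference evenCrank? (suc n) L ⟩
  gf (paritySign ∘ crank) L (suc n)
    ≡⟨ gf-cong L (λ {ps} _ → paritySign-crank ps) (suc n) ⟩
  gf (λ ps → withOne-sign ps +ᶻ withoutOne-sign ps) L (suc n)
    ≡⟨ gf-⊕ withOne-sign withoutOne-sign L (suc n) ⟩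
  gf withOne-sign L (suc n) +ᶻ gf withoutOne-sign L (suc n)
    -- In degree `suc n`, `shift 1` reads the product in degree `n`, and the empty partition
    -- contributes `𝟙 (suc n)`, which is 0.
    ≡⟨ cong₂ _+ᶻ_ (gf-withOne n (suc n)) (gf-withoutOne n (suc n)) ⟩
  -1ℤ *ᶻ p n +ᶻ (0ℤ +ᶻ noOnes n (suc n))
    ≡⟨ rearrange (p n) (noOnes n (suc n)) ⟩
  noOnes n (suc n) - (p n - 0ℤ)
    -- The infinite product in degree `n` is cut off at `suc n` factors, one more than in `p`. That
    -- factor changes `p n` by `shift (2 + n) p n`, which is 0.
    ≡⟨ cong₂ _-_ (noOnes≡pentagonal n (suc n) ℕₚ.≤-refl)
         (cong (λ x → p n - x) (sym (shift-low p (ℕₚ.m≤n+m (suc n) 1)))) ⟩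
  pentagonal/[1+q] (suc n) - (p n - shift (2 + n) p n)
    ≡⟨ cong (λ x → pentagonal/[1+q] (suc n) - x)
         (trans (q^-⊛ 1 ⟨ q^ 2 ⨾q⟩∞ (suc n)) (qPochFactor-⊛ n p n)) ⟨
  pentagonal/[1+q] (suc n) - (q^ 1 ⊛ ⟨ q^ 2 ⨾q⟩∞) (suc n) ∎
  where
  L = decreasingLists (suc n)
  p = ∏< (qPochFactor (q^ 2)) n
  rearrange : ∀ a b → -1ℤ *ᶻ a +ᶻ (0ℤ +ᶻ b) ≡ b - (a - 0ℤ)
  rearrange = ℤ-Solver.solve-∀
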